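{- Let $\sigma$ be well-behaved and let $\lambda^*$ be a stable configuration of $\sigma$-Bulgarian solitaire (with some number $n^*$ of cards). Total surplus and total deficit with respect to $\lambda^*$ may decrease but never increase during play: for every configuration $\lambda$ (with any number $n$ of cards), if $\lambda^{\mathrm{new}}$ denotes the configuration obtained from $\lambda$ by one move of $\sigma$-Bulgarian solitaire, then $$d^+_{\mathrm{tot}}(\lambda^{\mathrm{new}})\le d^+_{\mathrm{tot}}(\lambda)\quad\text{and}\quad d^-_{\mathrm{tot}}(\lambda^{\mathrm{new}})\le d^-_{\mathrm{tot}}(\lambda).$$
   Context: A configuration of $n$ cards is an integer partition $\lambda=(\lambda_1\ge\lambda_2\ge\cdots\ge\lambda_\ell>0)$ of $n$, extended by $\lambda_i=0$ for $i>\ell$. A function $\sigma$ from the positive integers to the nonnegative integers with $\sigma(h)\le h$ for all $h$ is well-behaved if $\sigma(1)=1$, $\sigma(h)$ is non-decreasing in $h$, and $h-\sigma(h)$ is non-decreasing in $h$. In a move of $\sigma$-Bulgarian solitaire, $\sigma(h)$ cards are picked from each nonempty pile of size $h$, all picked cards together form one new pile, and the resulting piles are sorted in weakly decreasing order (empty piles being discarded). A configuration is stable if a move leaves it unchanged. With respect to the fixed stable reference configuration $\lambda^*$, the total surplus and total deficit of $\lambda$ are $$d^+_{\mathrm{tot}}(\lambda)=\sum_{i\ge1}\max(\lambda_i-\lambda^*_i,0),\qquad d^-_{\mathrm{tot}}(\lambda)=\sum_{i\ge1}\max(\lambda^*_i-\lambda_i,0).$$ -}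

module Defs where

open import Data.List using (List; []; _∷_; map; sum; filter; length; upTo)
open import Data.List.Relation.Unary.All using (All; []; _∷_)
open import Data.List.Relation.Unary.All.Properties using (all-filter)
open import Data.List.Relation.Unary.Linked using (Linked)
open import Data.List.Relation.Binary.Permutation.Propositional using (↭-sym)
open import Data.List.Relation.Binary.Permutation.Propositional.Properties using (All-resp-↭)
open import Data.Nat using (ℕ; zero; suc; _+_; _∸_; _⊔_; _≤_; _≥_; _<_; _<?_)
open import Data.Nat.ListAction.Properties using (sum-↭)
open import Data.Nat.Properties using (≤-decTotalOrder; m+[n∸m]≡n; +-assoc; +-comm)
open import Relation.Binary.PropositionalEquality using (_≡_; refl; sym; trans; cong; cong₂; module ≡-Reasoning)
import Data.List.Sort as Sort
import Relation.Binary.Construct.Flip.EqAndOrd as Flip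

open Sort (Flip.decTotalOrder ≤-decTotalOrder) public
  using () renaming (sort to sort≥; sort-↭ to sort≥-↭; sort-↗ to sort≥-↗)

record Configuration (n : ℕ) : Set where
  field
    parts    : List ℕ
    sorted   : Linked _≥_ parts
    positive : All (0 <_) parts
    size     : sum parts ≡ n

open Configuration public

nth : List ℕ → ℕ → ℕ
nth []       _       = 0
nth (x ∷ xs) zero    = x
nth (x ∷ xs) (suc i) = nth xs i

-- Indices start at 0, so  part c i  is λᵢ₊₁; it is 0 past the last pile.
part : ∀ {n} → Configuration n → ℕ → ℕ
part c = nth (parts c)

-- A function from the positive integers with σ(h) ≤ h.  The value  pick 0
-- is unconstrained and never used, since all piles are nonempty.
record PickRule : Set where
  field
    pick   : ℕ → ℕ
    pick-≤ : ∀ {h} → 0 < h → pick h ≤ h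

open PickRule public

-- By  pick-≤  the truncated subtraction below is ordinary subtraction.
remaining : PickRule → ℕ → ℕ
remaining σ h = h ∸ pick σ h

record WellBehaved (σ : PickRule) : Set where
  field
    pick-1         : pick σ 1 ≡ 1
    pick-mono      : ∀ {h k} → 0 < h → h ≤ k → pick σ h ≤ pick σ k
    remaining-mono : ∀ {h k} → 0 < h → h ≤ k → remaining σ h ≤ remaining σ k

newPiles : PickRule → List ℕ → List ℕ
newPiles σ hs = sum (map (pick σ) hs) ∷ map (remaining σ) hs

moveParts : PickRule → List ℕ → List ℕ
moveParts σ hs = sort≥ (filter (0 <?_) (newPiles σ hs))

private
  sum-filter : ∀ hs → sum (filter (0 <?_) hs) ≡ sum hs
  sum-filter []           = refl
  sum-filter (zero  ∷ hs) = sum-filter hs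
  sum-filter (suc h ∷ hs) = cong (suc h +_) (sum-filter hs)

  sum-newPiles : ∀ σ {hs} → All (0 <_) hs → sum (newPiles σ hs) ≡ sum hs
  sum-newPiles σ [] = refl
  sum-newPiles σ {h ∷ hs} (0<h ∷ 0<hs) = begin
    (p + P) + (r + R)  ≡⟨ +-assoc p P (r + R) ⟩
    p + (P + (r + R))  ≡⟨ cong (p +_) (+-assoc P r R) ⟨
    p + ((P + r) + R)  ≡⟨ cong (λ x → p + (x + R)) (+-comm P r) ⟩
    p + ((r + P) + R)  ≡⟨ cong (p +_) (+-assoc r P R) ⟩
    p + (r + (P + R))  ≡⟨ +-assoc p r (P + R) ⟨
    (p + r) + (P + R)  ≡⟨ cong₂ _+_ (m+[n∸m]≡n (pick-≤ σ 0<h)) (sum-newPiles σ 0<hs) ⟩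
    h + sum hs         ∎
    where
    open ≡-Reasoning
    p = pick σ h
    r = remaining σ h
    P = sum (map (pick σ) hs)
    R = sum (map (remaining σ) hs)

move : ∀ {n} → PickRule → Configuration n → Configuration n
move σ c = record
  { parts    = moveParts σ (parts c)
  ; sorted   = sort≥-↗ piles
  ; positive = All-resp-↭ (↭-sym (sort≥-↭ piles)) (all-filter (0 <?_) (newPiles σ (parts c)))
  ; size     = trans (sum-↭ (sort≥-↭ piles))
                 (trans (sum-filter (newPiles σ (parts c)))
                   (trans (sum-newPiles σ (positive c)) (size c)))
  }
  where
  piles = filter (0 <?_) (newPiles σ (parts c))

Stable : ∀ {n} → PickRule → Configuration n → Set
Stable σ c = parts (move σ c) ≡ parts c

-- max(a - b, 0) is a ∸ b, and all summands vanish from the larger number of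
-- piles onwards, so the infinite sums are cut off there.
surplus : ∀ {n* n} → Configuration n* → Configuration n → ℕ
surplus c* c =
  sum (map (λ i → part c i ∸ part c* i) (upTo (length (parts c) ⊔ length (parts c*))))

deficit : ∀ {n* n} → Configuration n* → Configuration n → ℕ
deficit c* c =
  sum (map (λ i → part c* i ∸ part c i) (upTo (length (parts c) ⊔ length (parts c*))))

{-# OPTIONS --safe #-}
-- Sorting both arguments can only lower  Σᵢ max(aᵢ − bᵢ, 0):  cut the piles
-- into horizontal levels.  If level t is reached by α piles of a and β piles
-- of b, it contributes max(α − β, 0) when both lists are sorted, and at least
-- that much in any order.  So the sum for two moved configurations is at most
-- the one for the unsorted piles, where the remainders stay aligned with the
-- piles they come from and the two picked piles come first.  There, since pick
-- and remainder are both monotone, the contributions of two aligned piles a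
-- and b add up to at most max(a − b, 0).  Thus a move of both configurations
-- never increases the sum, and a stable configuration is its own move.
module Submission where

open import Defs
open import Algebra.Properties.CommutativeSemigroup using (interchange)
open import Data.List using (List; []; _∷_; map; filter; length; upTo; applyUpTo)
open import Data.List.Properties using (map-upTo; map-id-local)
open import Data.List.Relation.Binary.Permutation.Propositional using (_↭_)
open import Data.List.Relation.Binary.Permutation.Propositional.Properties using (map⁺)
open import Data.List.Relation.Unary.All as All using (All; []; _∷_)
import Data.List.Relation.Unary.All.Properties as All
open import Data.List.Relation.Unary.Linked as Linked using (Linked)
import Data.List.Relation.Unary.Linked.Properties as Linked
open import Data.Nat using (ℕ; zero; suc; _+_; _∸_; _⊓_; _≤_; _≥_; _<_; _<?_; z≤n; s≤s)
open import Data.Nat.ListAction using (sum)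
open import Data.Nat.ListAction.Properties using (sum-↭)
open import Data.Nat.Properties
open import Data.Product using (_×_; _,_)
open import Data.Sum using (inj₁; inj₂)
open import Function using (_∘_)
open import Relation.Binary.PropositionalEquality
  using (_≡_; refl; sym; trans; cong; cong₂; subst; subst₂; module ≡-Reasoning)

∑ : ℕ → (ℕ → ℕ) → ℕ
∑ n f = sum (applyUpTo f n)

∑-mono : ∀ n {f g : ℕ → ℕ} → (∀ i → f i ≤ g i) → ∑ n f ≤ ∑ n g
∑-mono zero    f≤g = z≤n
∑-mono (suc n) f≤g = +-mono-≤ (f≤g 0) (∑-mono n (f≤g ∘ suc))

+-interchange : ∀ a b c d → (a + b) + (c + d) ≡ (a + c) + (b + d)
+-interchange = interchange +-commutativeSemigroup

∑-0 : ∀ n → ∑ n (λ _ → 0) ≡ 0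
∑-0 zero    = refl
∑-0 (suc n) = ∑-0 n

∑-+ : ∀ n (f g : ℕ → ℕ) → ∑ n (λ i → f i + g i) ≡ ∑ n f + ∑ n g
∑-+ zero    f g = refl
∑-+ (suc n) f g = trans
  (cong (f 0 + g 0 +_) (∑-+ n (f ∘ suc) (g ∘ suc)))
  (+-interchange (f 0) (g 0) (∑ n (f ∘ suc)) (∑ n (g ∘ suc)))

∸-+-subadditive : ∀ a b c d → (a + b) ∸ (c + d) ≤ (a ∸ c) + (b ∸ d)
∸-+-subadditive a b c d = m≤n+o⇒m∸n≤o (a + b) (c + d)
  (subst (a + b ≤_) (+-interchange c (a ∸ c) d (b ∸ d))
    (+-mono-≤ (m≤n+m∸n a c) (m≤n+m∸n b d)))

-- A recursive form of the sums in `surplus` and `deficit`. These differ only in the order of the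
-- arguments, so one inequality about `excess` serves both.
excess : List ℕ → List ℕ → ℕ
excess []       ys       = 0
excess (x ∷ xs) []       = x + excess xs []
excess (x ∷ xs) (y ∷ ys) = (x ∸ y) + excess xs ys

-- Past the end of `xs` every term is `0 ∸ y`, so a cut-off beyond `xs` loses nothing.
excess-nth : ∀ xs ys {n} → length xs ≤ n →
             sum (map (λ i → nth xs i ∸ nth ys i) (upTo n)) ≡ excess xs ys
excess-nth xs ys {n} xs≤n = trans
  (cong sum (map-upTo (λ i → nth xs i ∸ nth ys i) n)) (go xs ys n xs≤n)
  where
  go : ∀ xs ys n → length xs ≤ n → ∑ n (λ i → nth xs i ∸ nth ys i) ≡ excess xs ys
  go []       ys       zero    _       = refl
  go []       []       (suc n) _       = go [] [] n z≤n
  go []       (y ∷ ys) (suc n) _       = cong₂ _+_ (0∸n≡0 y) (go [] ys n z≤n)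
  go (x ∷ xs) []       (suc n) (s≤s p) = cong (x +_) (go xs [] n p)
  go (x ∷ xs) (y ∷ ys) (suc n) (s≤s p) = cong (x ∸ y +_) (go xs ys n p)

excess≤sum : ∀ xs ys → excess xs ys ≤ sum xs
excess≤sum []       ys       = z≤n
excess≤sum (x ∷ xs) []       = +-monoʳ-≤ x (excess≤sum xs [])
excess≤sum (x ∷ xs) (y ∷ ys) = +-mono-≤ (m∸n≤m x y) (excess≤sum xs ys)

-- Subadditivity of truncated subtraction, iterated. It is applied both to a single level of
-- unsorted piles and to the two piles of picked cards.
sum∸sum≤excess : ∀ xs ys → sum xs ∸ sum ys ≤ excess xs ys
sum∸sum≤excess []       ys       = ≤-reflexive (0∸n≡0 (sum ys))
sum∸sum≤excess (x ∷ xs) []       = +-monoʳ-≤ x (sum∸sum≤excess xs [])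
sum∸sum≤excess (x ∷ xs) (y ∷ ys) = ≤-trans
  (∸-+-subadditive x (sum xs) y (sum ys))
  (+-monoʳ-≤ (x ∸ y) (sum∸sum≤excess xs ys))

excess-map-≤ : ∀ {f : ℕ → ℕ} → (∀ x → f x ≤ x) → ∀ xs ys →
               excess (map f xs) ys ≤ excess xs ys
excess-map-≤ f≤ []       ys       = z≤n
excess-map-≤ f≤ (x ∷ xs) []       = +-mono-≤ (f≤ x) (excess-map-≤ f≤ xs [])
excess-map-≤ f≤ (x ∷ xs) (y ∷ ys) =
  +-mono-≤ (∸-monoˡ-≤ y (f≤ x)) (excess-map-≤ f≤ xs ys)

sum-sorted-0 : ∀ {xs} → Linked _≥_ (0 ∷ xs) → sum xs ≡ 0
sum-sorted-0 {[]}        _                   = refl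
sum-sorted-0 {zero ∷ xs} (z≤n Linked.∷ 0∷xs) = sum-sorted-0 0∷xs

-- A sorted 0-1 list is a block of ones followed by zeros. Aligned ones cancel; once either list
-- reaches a zero, the rest of it sums to 0.
excess-sorted-01 : ∀ {xs ys} → Linked _≥_ xs → Linked _≥_ ys → All (_≤ 1) xs → All (_≤ 1) ys →
                   excess xs ys ≤ sum xs ∸ sum ys
excess-sorted-01 {[]}     {ys} _   _   _        _ = z≤n
excess-sorted-01 {x ∷ xs} {[]} _   _   _        _ = excess≤sum (x ∷ xs) []
excess-sorted-01 {x ∷ xs} {zero ∷ ys} _ 0∷ys _ _
  rewrite sum-sorted-0 0∷ys = excess≤sum (x ∷ xs) (zero ∷ ys)
excess-sorted-01 {zero ∷ xs} {suc y ∷ ys} 0∷xs _ _ _ = ≤-trans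
  (≤-trans (excess≤sum xs ys) (≤-reflexive (sum-sorted-0 0∷xs))) z≤n
excess-sorted-01 {suc zero ∷ xs} {suc zero ∷ ys} sxs sys (_ ∷ xs≤1) (_ ∷ ys≤1) =
  excess-sorted-01 (Linked.tail sxs) (Linked.tail sys) xs≤1 ys≤1
excess-sorted-01 {suc (suc _) ∷ _} {suc _ ∷ _} _ _ (s≤s () ∷ _) _
excess-sorted-01 {suc zero ∷ _} {suc (suc _) ∷ _} _ _ _ (s≤s () ∷ _)

-- The indicator of  t < h.
above : ℕ → ℕ → ℕ
above _       zero    = 0
above zero    (suc h) = 1
above (suc t) (suc h) = above t h

above≤1 : ∀ t h → above t h ≤ 1
above≤1 t       zero    = z≤n
above≤1 zero    (suc h) = s≤s z≤n
above≤1 (suc t) (suc h) = above≤1 t h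

above-mono : ∀ t {h k} → h ≤ k → above t h ≤ above t k
above-mono t       z≤n       = z≤n
above-mono zero    (s≤s h≤k) = ≤-refl
above-mono (suc t) (s≤s h≤k) = above-mono t h≤k

-- Level `t` contributes 1 exactly when `b ≤ t < a`, and only levels below `T` are summed.
∑-above : ∀ T a b → ∑ T (λ t → above t a ∸ above t b) ≡ (a ⊓ T) ∸ b
∑-above zero    a       b       = sym (trans (cong (_∸ b) (⊓-zeroʳ a)) (0∸n≡0 b))
∑-above (suc T) zero    zero    = ∑-above T 0 0
∑-above (suc T) zero    (suc b) = trans (∑-above T 0 b) (0∸n≡0 b)
∑-above (suc T) (suc a) zero    = cong suc (∑-above T a 0)
∑-above (suc T) (suc a) (suc b) = ∑-above T a b

∑-excess-above : ∀ T xs ys →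
  ∑ T (λ t → excess (map (above t) xs) (map (above t) ys)) ≡ excess (map (_⊓ T) xs) ys
∑-excess-above T []       ys       = ∑-0 T
-- A missing partner acts as a pile of height `0`, which reaches no level.
∑-excess-above T (x ∷ xs) []       = trans
  (∑-+ T (λ t → above t x) _)
  (cong₂ _+_ (∑-above T x 0) (∑-excess-above T xs []))
∑-excess-above T (x ∷ xs) (y ∷ ys) = trans
  (∑-+ T (λ t → above t x ∸ above t y) _)
  (cong₂ _+_ (∑-above T x y) (∑-excess-above T xs ys))

-- For a partition these are the parts of its conjugate, indexed from 0. The value ignores order and
-- zero entries, so it survives filtering and sorting.
count : ℕ → List ℕ → ℕ
count t xs = sum (map (above t) xs)

∑-count≤excess : ∀ T xs ys → ∑ T (λ t → count t xs ∸ count t ys) ≤ excess xs ys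
∑-count≤excess T xs ys = begin
  ∑ T (λ t → count t xs ∸ count t ys)
    ≤⟨ ∑-mono T (λ t → sum∸sum≤excess (map (above t) xs) (map (above t) ys)) ⟩
  ∑ T (λ t → excess (map (above t) xs) (map (above t) ys))
    ≡⟨ ∑-excess-above T xs ys ⟩
  excess (map (_⊓ T) xs) ys
    ≤⟨ excess-map-≤ (λ x → m⊓n≤m x T) xs ys ⟩
  excess xs ys ∎
  where open ≤-Reasoning

-- Converse of `∑-count≤excess` for sorted lists: each level is then a pair of sorted 0-1 lists, and
-- the bound `T` makes the truncation `_⊓ T` the identity on `xs`.
excess-sorted≤∑-count : ∀ {T xs ys} → Linked _≥_ xs → Linked _≥_ ys → All (_≤ T) xs →
                        excess xs ys ≤ ∑ T (λ t → count t xs ∸ count t ys)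
excess-sorted≤∑-count {T} {xs} {ys} sxs sys xs≤T = begin
  excess xs ys
    ≡⟨ cong (λ zs → excess zs ys) (map-id-local (All.map m≤n⇒m⊓n≡m xs≤T)) ⟨
  excess (map (_⊓ T) xs) ys
    ≡⟨ ∑-excess-above T xs ys ⟨
  ∑ T (λ t → excess (map (above t) xs) (map (above t) ys))
    ≤⟨ ∑-mono T (λ t → excess-sorted-01 (levels-sorted t sxs) (levels-sorted t sys)
                                        (levels≤1 t xs) (levels≤1 t ys)) ⟩
  ∑ T (λ t → count t xs ∸ count t ys) ∎
  where
  open ≤-Reasoning
  levels-sorted : ∀ t {zs} → Linked _≥_ zs → Linked _≥_ (map (above t) zs)
  levels-sorted t = Linked.map⁺ ∘ Linked.map (above-mono t)
  levels≤1 : ∀ t zs → All (_≤ 1) (map (above t) zs)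
  levels≤1 t zs = All.map⁺ (All.universal (above≤1 t) zs)

count-filter : ∀ t xs → count t (filter (0 <?_) xs) ≡ count t xs
count-filter t []           = refl
count-filter t (zero  ∷ xs) = count-filter t xs
count-filter t (suc x ∷ xs) = cong (above t (suc x) +_) (count-filter t xs)

count-↭ : ∀ t {xs ys} → xs ↭ ys → count t xs ≡ count t ys
count-↭ t xs↭ys = sum-↭ (map⁺ (above t) xs↭ys)

count-moveParts : ∀ σ t hs → count t (moveParts σ hs) ≡ count t (newPiles σ hs)
count-moveParts σ t hs = trans (count-↭ t (sort≥-↭ (filter (0 <?_) (newPiles σ hs))))
                               (count-filter t (newPiles σ hs))

all≤sum : ∀ xs → All (_≤ sum xs) xs
all≤sum []       = []
all≤sum (x ∷ xs) =
  m≤m+n x (sum xs) ∷ All.map (λ y≤ → ≤-trans y≤ (m≤n+m (sum xs) x)) (all≤sum xs)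

excess-moveParts≤excess-newPiles : ∀ σ hs ks →
  excess (moveParts σ hs) (moveParts σ ks) ≤ excess (newPiles σ hs) (newPiles σ ks)
excess-moveParts≤excess-newPiles σ hs ks = begin
  excess (moveParts σ hs) (moveParts σ ks)
    ≤⟨ excess-sorted≤∑-count (sort≥-↗ _) (sort≥-↗ _) (all≤sum (moveParts σ hs)) ⟩
  ∑ T (λ t → count t (moveParts σ hs) ∸ count t (moveParts σ ks))
    ≤⟨ ∑-mono T (λ t → ≤-reflexive
         (cong₂ _∸_ (count-moveParts σ t hs) (count-moveParts σ t ks))) ⟩
  ∑ T (λ t → count t (newPiles σ hs) ∸ count t (newPiles σ ks))
    ≤⟨ ∑-count≤excess T (newPiles σ hs) (newPiles σ ks) ⟩
  excess (newPiles σ hs) (newPiles σ ks) ∎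
  where
  open ≤-Reasoning
  -- Any upper bound on the entries of `moveParts σ hs` would do as the number of levels.
  T = sum (moveParts σ hs)

pick+remaining : ∀ σ {h} → 0 < h → pick σ h + remaining σ h ≡ h
pick+remaining σ 0<h = m+[n∸m]≡n (pick-≤ σ 0<h)

module _ (σ : PickRule) (wb : WellBehaved σ) where
  open WellBehaved wb

  -- By monotonicity both differences vanish if `h ≤ k`. If `k ≤ h`, neither is truncated, and they
  -- add up to `h ∸ k` because pick and remainder make up the pile.
  pick∸+remaining∸ : ∀ {h k} → 0 < h → 0 < k →
    (pick σ h ∸ pick σ k) + (remaining σ h ∸ remaining σ k) ≤ h ∸ k
  pick∸+remaining∸ {h} {k} 0<h 0<k with ≤-total h k
  ... | inj₁ h≤k = ≤-trans
    (≤-reflexive (cong₂ _+_ (m≤n⇒m∸n≡0 (pick-mono 0<h h≤k))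
                            (m≤n⇒m∸n≡0 (remaining-mono 0<h h≤k)))) z≤n
  ... | inj₂ k≤h = m+n≤o⇒m≤o∸n (dp + dr) (≤-reflexive (begin
    (dp + dr) + k              ≡⟨ +-comm (dp + dr) k ⟩
    k + (dp + dr)              ≡⟨ cong (_+ (dp + dr)) (pick+remaining σ 0<k) ⟨
    (pick σ k + remaining σ k) + (dp + dr)
                               ≡⟨ +-interchange (pick σ k) (remaining σ k) dp dr ⟩
    (pick σ k + dp) + (remaining σ k + dr)
                               ≡⟨ cong₂ _+_ (m+[n∸m]≡n (pick-mono 0<k k≤h))
                                            (m+[n∸m]≡n (remaining-mono 0<k k≤h)) ⟩
    pick σ h + remaining σ h   ≡⟨ pick+remaining σ 0<h ⟩
    h                          ∎))
    where
    open ≡-Reasoning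
    dp = pick σ h ∸ pick σ k
    dr = remaining σ h ∸ remaining σ k

  excess-pick+excess-remaining : ∀ {hs ks} → All (0 <_) hs → All (0 <_) ks →
    excess (map (pick σ) hs) (map (pick σ) ks) +
    excess (map (remaining σ) hs) (map (remaining σ) ks) ≤ excess hs ks
  excess-pick+excess-remaining [] _ = z≤n
  -- A pile without a partner counts in full, as its pick plus its remainder.
  excess-pick+excess-remaining {h ∷ hs} {[]} (0<h ∷ 0<hs) [] = ≤-trans
    (≤-reflexive (+-interchange (pick σ h) _ (remaining σ h) _))
    (+-mono-≤ (≤-reflexive (pick+remaining σ 0<h)) (excess-pick+excess-remaining 0<hs []))
  excess-pick+excess-remaining {h ∷ hs} {k ∷ ks} (0<h ∷ 0<hs) (0<k ∷ 0<ks) = ≤-trans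
    (≤-reflexive (+-interchange (pick σ h ∸ pick σ k) _ (remaining σ h ∸ remaining σ k) _))
    (+-mono-≤ (pick∸+remaining∸ 0<h 0<k) (excess-pick+excess-remaining 0<hs 0<ks))

  excess-moveParts : ∀ {hs ks} → All (0 <_) hs → All (0 <_) ks →
                     excess (moveParts σ hs) (moveParts σ ks) ≤ excess hs ks
  excess-moveParts {hs} {ks} 0<hs 0<ks = begin
    excess (moveParts σ hs) (moveParts σ ks)
      ≤⟨ excess-moveParts≤excess-newPiles σ hs ks ⟩
    excess (newPiles σ hs) (newPiles σ ks)
      -- The heads of the two `newPiles` lists are the totals of picked cards; their difference is
      -- split into contributions of the original piles.
      ≤⟨ +-monoˡ-≤ _ (sum∸sum≤excess (map (pick σ) hs) (map (pick σ) ks)) ⟩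
    excess (map (pick σ) hs) (map (pick σ) ks) +
    excess (map (remaining σ) hs) (map (remaining σ) ks)
      ≤⟨ excess-pick+excess-remaining 0<hs 0<ks ⟩
    excess hs ks ∎
    where open ≤-Reasoning

surplus≡excess : ∀ {n* n} (c* : Configuration n*) (c : Configuration n) →
                 surplus c* c ≡ excess (parts c) (parts c*)
surplus≡excess c* c = excess-nth (parts c) (parts c*) (m≤m⊔n _ _)

deficit≡excess : ∀ {n* n} (c* : Configuration n*) (c : Configuration n) →
                 deficit c* c ≡ excess (parts c*) (parts c)
deficit≡excess c* c = excess-nth (parts c*) (parts c) (m≤n⊔m (length (parts c)) _)

theorem4 : (σ : PickRule) → WellBehaved σ →
    (n* : ℕ) (c* : Configuration n*) → Stable σ c* →
    (n : ℕ) (c : Configuration n) →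
    (surplus c* (move σ c) ≤ surplus c* c) × (deficit c* (move σ c) ≤ deficit c* c)
theorem4 σ wb n* c* stable n c =
    subst₂ _≤_ (sym (surplus≡excess c* (move σ c))) (sym (surplus≡excess c* c))
      -- The inequality has both configurations moved; `stable` turns the moved parts of `c*` back
      -- into `parts c*`.
      (subst (λ ks → excess (moveParts σ (parts c)) ks ≤ excess (parts c) (parts c*)) stable
        (excess-moveParts σ wb (positive c) (positive c*)))
  , subst₂ _≤_ (sym (deficit≡excess c* (move σ c))) (sym (deficit≡excess c* c))
      (subst (λ hs → excess hs (moveParts σ (parts c)) ≤ excess (parts c*) (parts c)) stable
        (excess-moveParts σ wb (positive c*) (positive c)))
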